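{- Let $\mathcal{A}=(a_i)_{i=1}^\infty$ be a weakly increasing sequence of positive integers, let $r$ be a positive integer and let $k>2r$ be an integer. Suppose that $\gcd A=1$ for every $(k-2r)$-multisubset $A$ of $\{a_1,a_2,\ldots,a_k\}$. Then the sequence $\left(p_\mathcal{A}(n,k)\right)_{n=0}^\infty$ is asymptotically $r$-log-concave.
   Context: For a weakly increasing sequence $\mathcal{A}=(a_i)_{i\ge1}$ of positive integers and a positive integer $k$, $p_\mathcal{A}(n,k)$ is defined by $\sum_{n\ge0}p_\mathcal{A}(n,k)x^n=\prod_{i=1}^k\frac{1}{1-x^{a_i}}$ (the number of partitions of $n$ into parts from the multiset $\{a_1,\dots,a_k\}$, equal values with different indices counting as different parts); $p_\mathcal{A}(n,k)=0$ for $n<0$. A $j$-multisubset of $\{a_1,\dots,a_k\}$ is a multiset $\{a_i : i\in I\}$ with $I\subseteq\{1,\dots,k\}$, $|I|=j$. For a real sequence $\omega=(w_i)_{i\ge0}$ put $(\widehat{\mathcal{L}}\omega)_i=w_{i+1}^2-w_iw_{i+2}$ and $\widehat{\mathcal{L}}^j\omega=\widehat{\mathcal{L}}(\widehat{\mathcal{L}}^{j-1}\omega)$. The sequence $\omega$ is asymptotically $r$-log-concave if there is $N$ such that $(\widehat{\mathcal{L}}^j\omega)_i>0$ for all $j\in\{1,\dots,r\}$ and all $i\ge N$. -}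

module Defs where

open import Data.Nat using (ℕ; zero; suc; _+_; _*_; _∸_; _≤_)
open import Data.Nat.GCD using (gcd)
open import Data.Nat.Divisibility using (_∣?_)
open import Data.Integer as ℤ using (ℤ)
open import Data.Fin using (Fin)
open import Data.Fin.Subset using (Subset; _∈_)
open import Data.Fin.Subset.Properties using (_∈?_)
open import Data.Product using (∃; _×_)
open import Relation.Nullary using (does)
open import Data.Bool using (if_then_else_)
open import Data.List using (List; []; _∷_; allFin)

Series : Set
Series = ℕ → ℕ

sumTo : (ℕ → ℕ) → ℕ → ℕ
sumTo f zero    = f zero
sumTo f (suc n) = sumTo f n + f (suc n)

_⊛_ : Series → Series → Series
(f ⊛ g) n = sumTo (λ i → f i * g (n ∸ i)) n

one : Series
one zero    = 1
one (suc _) = 0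

-- 1/(1 - x^a) = Σ_m x^{m a}  (for a ≥ 1): coefficient of x^n is 1 iff a ∣ n
geom : ℕ → Series
geom a n = if does (a ∣? n) then 1 else 0

-- Sequence A = (a_1, a_2, ...) is represented 0-indexed: a i = a_{i+1}.
-- p_A(·,k) = coefficients of ∏_{i=1}^{k} 1/(1 - x^{a_i}).
pA : (ℕ → ℕ) → ℕ → Series
pA a zero    = one
pA a (suc k) = pA a k ⊛ geom (a k)

-- gcd of the multiset {a_{i+1} : i ∈ I} for I ⊆ {0,…,k-1}  (gcd ∅ = 0)
gcdSub : {k : ℕ} → (Fin k → ℕ) → Subset k → ℕ
gcdSub {k} a I = go (allFin k)
  where
  go : List (Fin k) → ℕ
  go [] = 0
  go (i ∷ is) = if does (i ∈? I) then gcd (a i) (go is) else go is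

L : (ℕ → ℤ) → (ℕ → ℤ)
L w i = w (suc i) ℤ.* w (suc i) ℤ.- w i ℤ.* w (suc (suc i))

L^ : ℕ → (ℕ → ℤ) → (ℕ → ℤ)
L^ zero    w = w
L^ (suc j) w = L (L^ j w)

AsymptLogConcave : ℕ → (ℕ → ℤ) → Set
AsymptLogConcave r w =
  ∃ λ N → ∀ j → 1 ≤ j → j ≤ r → ∀ i → N ≤ i → ℤ.0ℤ ℤ.< L^ j w i

{-# OPTIONS --safe #-}
module Submission where

-- Let S be the shift, Δ = S − 1 and p(n) = p_A(n,k).  Factors S^a − 1 cancel factors of the
-- generating function, so applying S^{a_i} − 1 for all i ∈ I leaves a sequence of size
-- O(n^{k−|I|−1}).  By Bézout, S^{gcd(a,b)} − 1 lies in the ideal of ℤ[S] generated by S^a − 1 and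
-- S^b − 1; since the gcd of the a_i outside any set of at most 2r indices is 1, each such factor
-- can be traded for a Δ, and Δ^{2r+1} p = O(n^{k−2r−2}).  On the other hand, for the product
-- Q = ∏ (1 + S + ⋯ + S^{a_i−1}) the sequence Δ^{k−1} Q p is a positive constant, and Q p agrees
-- with (∏ a_i) p up to terms with an additional Δ.  Hence Δ^i p behaves like the i-th derivative
-- of a multiple of n^{k−1} for all i ≤ 2r.  If Δ^i w behaves like (c n^d)^{(i)} for i ≤ m + 2,
-- then L w = (Δw)² − w·Δ²w behaves in the same way like d c² n^{2d−2} for i ≤ m, so L can be
-- applied r times.

open import Defs
open import Data.Nat using (ℕ; zero; suc; _+_; _*_; _∸_; _^_; _≤_; _<_; _⊔_; _!; z≤n; s≤s; >-nonZero)
open import Data.Nat.Properties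
open import Data.Nat.Divisibility using (_∣_; _∣?_; _∣0; ∣m+n∣m⇒∣n; ∣m∣n⇒∣m+n; ∣-refl; >⇒∤)
open import Data.Nat.GCD using (gcd; gcd-GCD; module Bézout)
open import Data.Nat.Induction using (<-rec)
open import Data.Integer as ℤ using (ℤ; +_; -[1+_]; +<+; +≤+) renaming (∣_∣ to ∥_∥)
import Data.Integer.Properties as ℤ
open import Data.Integer.Tactic.RingSolver using (solve-∀)
open import Data.Bool using (if_then_else_)
open import Data.Empty using () renaming (⊥ to Empty)
open import Data.Fin using (Fin; zero; suc; toℕ)
open import Data.Fin.Subset using (Subset; inside; outside; _∈_; _∉_; _⊆_; ∣_∣; ∁; ⊤; ⊥)
open import Data.Fin.Subset.Properties
  using (_∈?_; ∣⊥∣≡0; ⊥⊆; s⊆s; out⊆; ∣∁p∣≡n∸∣p∣; x∈∁p⇒x∉p; ∣p∣≡n⇒p≡⊤)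
open import Data.List using (List; allFin) renaming ([] to []ᴸ; _∷_ to _∷ᴸ_)
open import Data.Product using (∃; _×_; _,_)
open import Data.Sum using (inj₁; inj₂)
open import Data.Vec using ([]; _∷_; here; there; _[_]≔_)
open import Function using (_∘_)
open import Relation.Nullary using (¬_; yes; no; contradiction)
open import Relation.Nullary.Decidable using (dec-true; dec-false)
open import Relation.Binary.PropositionalEquality
  using (_≡_; refl; sym; trans; cong; cong₂; subst; subst₂; _≗_; module ≡-Reasoning)

-- Algebra of shift operators

Seq : Set
Seq = ℕ → ℤ

private variable
  j k m d d′ e e′ : ℕ
  c c′ : ℤ
  f g v w : Seq

-- Polynomials in the shift operator S; σ a stands for S^a and κ c for the constant c.
data Op : Set where
  σ : ℕ → Op
  κ : ℤ → Op
  _⊕_ _⊖_ _⊙_ : Op → Op → Op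

infixr 7 _⊙_
infixl 6 _⊕_ _⊖_

⟦_⟧ : Op → Seq → Seq
⟦ σ a ⟧ f n = f (a + n)
⟦ κ c ⟧ f n = c ℤ.* f n
⟦ P ⊕ Q ⟧ f n = ⟦ P ⟧ f n ℤ.+ ⟦ Q ⟧ f n
⟦ P ⊖ Q ⟧ f n = ⟦ P ⟧ f n ℤ.- ⟦ Q ⟧ f n
⟦ P ⊙ Q ⟧ f = ⟦ P ⟧ (⟦ Q ⟧ f)

-- The value of the polynomial at S = 1.
aug : Op → ℤ
aug (σ a) = ℤ.1ℤ
aug (κ c) = c
aug (P ⊕ Q) = aug P ℤ.+ aug Q
aug (P ⊖ Q) = aug P ℤ.- aug Q
aug (P ⊙ Q) = aug P ℤ.* aug Q

op-cong : ∀ P → f ≗ g → ⟦ P ⟧ f ≗ ⟦ P ⟧ g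
op-cong (σ a) eq n = eq (a + n)
op-cong (κ c) eq n = cong (c ℤ.*_) (eq n)
op-cong (P ⊕ Q) eq n = cong₂ ℤ._+_ (op-cong P eq n) (op-cong Q eq n)
op-cong (P ⊖ Q) eq n = cong₂ ℤ._-_ (op-cong P eq n) (op-cong Q eq n)
op-cong (P ⊙ Q) eq = op-cong P (op-cong Q eq)

op-+ : ∀ P → ⟦ P ⟧ (λ n → f n ℤ.+ g n) ≗ λ n → ⟦ P ⟧ f n ℤ.+ ⟦ P ⟧ g n
op-+ (σ a) n = refl
op-+ {f} {g} (κ c) n = ℤ.*-distribˡ-+ c (f n) (g n)
op-+ {f} {g} (P ⊕ Q) n = trans (cong₂ ℤ._+_ (op-+ P n) (op-+ Q n))
  (swap (⟦ P ⟧ f n) (⟦ P ⟧ g n) (⟦ Q ⟧ f n) (⟦ Q ⟧ g n))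
  where
  swap : ∀ w x y z → (w ℤ.+ x) ℤ.+ (y ℤ.+ z) ≡ (w ℤ.+ y) ℤ.+ (x ℤ.+ z)
  swap = solve-∀
op-+ {f} {g} (P ⊖ Q) n = trans (cong₂ ℤ._-_ (op-+ P n) (op-+ Q n))
  (swap (⟦ P ⟧ f n) (⟦ P ⟧ g n) (⟦ Q ⟧ f n) (⟦ Q ⟧ g n))
  where
  swap : ∀ w x y z → (w ℤ.+ x) ℤ.- (y ℤ.+ z) ≡ (w ℤ.- y) ℤ.+ (x ℤ.- z)
  swap = solve-∀
op-+ (P ⊙ Q) n = trans (op-cong P (op-+ Q) n) (op-+ P n)

op-κ : ∀ P c → ⟦ P ⟧ (⟦ κ c ⟧ f) ≗ ⟦ κ c ⟧ (⟦ P ⟧ f)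
op-κ (σ a) c n = refl
op-κ {f} (κ b) c n = swap b c (f n)
  where
  swap : ∀ x y z → x ℤ.* (y ℤ.* z) ≡ y ℤ.* (x ℤ.* z)
  swap = solve-∀
op-κ (P ⊕ Q) c n = trans (cong₂ ℤ._+_ (op-κ P c n) (op-κ Q c n)) (sym (ℤ.*-distribˡ-+ c _ _))
op-κ (P ⊖ Q) c n = trans (cong₂ ℤ._-_ (op-κ P c n) (op-κ Q c n)) (factor c _ _)
  where
  factor : ∀ x y z → x ℤ.* y ℤ.- x ℤ.* z ≡ x ℤ.* (y ℤ.- z)
  factor = solve-∀
op-κ (P ⊙ Q) c n = trans (op-cong P (op-κ Q c) n) (op-κ P c n)

op-- : ∀ P → ⟦ P ⟧ (λ n → f n ℤ.- g n) ≗ λ n → ⟦ P ⟧ f n ℤ.- ⟦ P ⟧ g n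
op-- {f} {g} P n = begin
  ⟦ P ⟧ (λ n → f n ℤ.- g n) n
    ≡⟨ op-cong P (λ n → cong (ℤ._+_ (f n)) (sym (ℤ.-1*i≡-i (g n)))) n ⟩
  ⟦ P ⟧ (λ n → f n ℤ.+ ⟦ κ ℤ.-1ℤ ⟧ g n) n
    ≡⟨ op-+ P n ⟩
  ⟦ P ⟧ f n ℤ.+ ⟦ P ⟧ (⟦ κ ℤ.-1ℤ ⟧ g) n
    ≡⟨ cong (ℤ._+_ (⟦ P ⟧ f n)) (trans (op-κ P ℤ.-1ℤ n) (ℤ.-1*i≡-i _)) ⟩
  ⟦ P ⟧ f n ℤ.- ⟦ P ⟧ g n ∎
  where open ≡-Reasoning

op-σ : ∀ P a → ⟦ P ⟧ (⟦ σ a ⟧ f) ≗ ⟦ σ a ⟧ (⟦ P ⟧ f)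
op-σ {f} (σ b) a n = cong f (trans (sym (+-assoc a b n))
  (trans (cong (_+ n) (+-comm a b)) (+-assoc b a n)))
op-σ (κ c) a n = refl
op-σ (P ⊕ Q) a n = cong₂ ℤ._+_ (op-σ P a n) (op-σ Q a n)
op-σ (P ⊖ Q) a n = cong₂ ℤ._-_ (op-σ P a n) (op-σ Q a n)
op-σ (P ⊙ Q) a n = trans (op-cong P (op-σ Q a) n) (op-σ P a n)

-- Induction on `Q` alone: sums and differences need only the additivity of `P`, and the leaves are
-- shifts and constants.
op-comm : ∀ P Q → ⟦ P ⟧ (⟦ Q ⟧ f) ≗ ⟦ Q ⟧ (⟦ P ⟧ f)
op-comm P (σ a) = op-σ P a
op-comm P (κ c) = op-κ P c
op-comm P (Q ⊕ R) n = trans (op-+ P n) (cong₂ ℤ._+_ (op-comm P Q n) (op-comm P R n))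
op-comm P (Q ⊖ R) n = trans (op-- P n) (cong₂ ℤ._-_ (op-comm P Q n) (op-comm P R n))
op-comm P (Q ⊙ R) n = trans (op-comm P Q n) (op-cong Q (op-comm P R) n)

D : ℕ → Op
D a = σ a ⊖ σ 0

Δ : Op
Δ = D 1

-- The new `Δ` acts first, so that unfolding agrees definitionally with the recursion of `S` below.
Δ^ : ℕ → Op
Δ^ zero = σ 0
Δ^ (suc j) = Δ^ j ⊙ Δ

-- The quotient (S^a - 1)/(S - 1) = 1 + S + ⋯ + S^{a-1}.
Box : ℕ → Op
Box zero = κ ℤ.0ℤ
Box (suc a) = Box a ⊕ σ a

Δ-Box : ∀ a → ⟦ Δ ⟧ (⟦ Box a ⟧ f) ≗ ⟦ D a ⟧ f
Δ-Box {f} a n = trans (op-comm Δ (Box a) n) (telescope a)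
  where
  glue : ∀ x y z → (x ℤ.- y) ℤ.+ (z ℤ.- x) ≡ z ℤ.- y
  glue = solve-∀
  telescope : ∀ a → ⟦ Box a ⟧ (⟦ Δ ⟧ f) n ≡ ⟦ D a ⟧ f n
  telescope zero = sym (ℤ.+-inverseʳ (f n))
  telescope (suc a) = trans (cong (λ x → x ℤ.+ ⟦ σ a ⟧ (⟦ Δ ⟧ f) n) (telescope a))
    (glue (f (a + n)) (f n) (f (suc (a + n))))

-- Polynomial growth bounds

-- f(n) = O(n^{e−k}).  Clearing the denominator makes the exponent −1 meaningful:
-- an integer sequence with Bd 1 0 f is eventually zero.
record Bd (k e : ℕ) (f : Seq) : Set where
  constructor bd
  field
    C : ℕ
    bound : ∀ n → suc n ^ k * ∥ f n ∥ ≤ C * suc n ^ e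

Bd-cong : f ≗ g → Bd k e f → Bd k e g
Bd-cong {k = k} {e} f≗g (bd C p) =
  bd C λ n → subst (λ x → suc n ^ k * ∥ x ∥ ≤ C * suc n ^ e) (f≗g n) (p n)

Bd-+ : Bd k e f → Bd k e g → Bd k e (λ n → f n ℤ.+ g n)
Bd-+ {k} {e} {f} {g} (bd C p) (bd C′ p′) = bd (C + C′) λ n → begin
  suc n ^ k * ∥ f n ℤ.+ g n ∥                  ≤⟨ *-monoʳ-≤ (suc n ^ k) (ℤ.∣i+j∣≤∣i∣+∣j∣ (f n) (g n)) ⟩
  suc n ^ k * (∥ f n ∥ + ∥ g n ∥)              ≡⟨ *-distribˡ-+ (suc n ^ k) _ _ ⟩
  suc n ^ k * ∥ f n ∥ + suc n ^ k * ∥ g n ∥    ≤⟨ +-mono-≤ (p n) (p′ n) ⟩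
  C * suc n ^ e + C′ * suc n ^ e               ≡⟨ *-distribʳ-+ (suc n ^ e) C C′ ⟨
  (C + C′) * suc n ^ e                         ∎
  where open ≤-Reasoning

Bd-* : Bd j e f → Bd k e′ g → Bd (j + k) (e + e′) (λ n → f n ℤ.* g n)
Bd-* {j} {e} {f} {k} {e′} {g} (bd C p) (bd C′ p′) = bd (C * C′) λ n → begin
  suc n ^ (j + k) * ∥ f n ℤ.* g n ∥               ≡⟨ cong₂ _*_ (^-distribˡ-+-* (suc n) j k) (ℤ.abs-* (f n) (g n)) ⟩
  suc n ^ j * suc n ^ k * (∥ f n ∥ * ∥ g n ∥)     ≡⟨ [m*n]*[o*p]≡[m*o]*[n*p] (suc n ^ j) _ _ _ ⟩
  suc n ^ j * ∥ f n ∥ * (suc n ^ k * ∥ g n ∥)     ≤⟨ *-mono-≤ (p n) (p′ n) ⟩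
  C * suc n ^ e * (C′ * suc n ^ e′)               ≡⟨ [m*n]*[o*p]≡[m*o]*[n*p] C _ _ _ ⟩
  C * C′ * (suc n ^ e * suc n ^ e′)               ≡⟨ cong (C * C′ *_) (^-distribˡ-+-* (suc n) e e′) ⟨
  C * C′ * suc n ^ (e + e′)                       ∎
  where open ≤-Reasoning

Bd-const : ∀ c → Bd 0 0 (λ _ → c)
Bd-const c = bd (∥ c ∥) λ n → ≤-reflexive (*-comm 1 ∥ c ∥)

Bd-κ : ∀ c → Bd k e f → Bd k e (⟦ κ c ⟧ f)
Bd-κ c = Bd-* (Bd-const c)

Bd-- : Bd k e f → Bd k e g → Bd k e (λ n → f n ℤ.- g n)
Bd-- {f = f} {g} p q =
  Bd-cong (λ n → cong (ℤ._+_ (f n)) (ℤ.-1*i≡-i (g n))) (Bd-+ p (Bd-κ ℤ.-1ℤ q))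

Bd-σ : ∀ a → Bd k e f → Bd k e (⟦ σ a ⟧ f)
Bd-σ {k} {e} {f} a (bd C p) = bd (C * suc a ^ e) λ n → begin
  suc n ^ k * ∥ f (a + n) ∥         ≤⟨ *-monoˡ-≤ _ (^-monoˡ-≤ k (s≤s (m≤n+m n a))) ⟩
  suc (a + n) ^ k * ∥ f (a + n) ∥   ≤⟨ p (a + n) ⟩
  -- `suc (a + n) ≤ suc n * suc a`, which is where the factor `suc a ^ e` comes from.
  C * suc (a + n) ^ e               ≤⟨ *-monoʳ-≤ C (^-monoˡ-≤ e (s≤s (+-monoʳ-≤ a (m≤m*n n (suc a))))) ⟩
  C * (suc a + n * suc a) ^ e       ≡⟨ cong (C *_) (^-distribʳ-* e (suc n) (suc a)) ⟩
  C * (suc n ^ e * suc a ^ e)       ≡⟨ cong (C *_) (*-comm (suc n ^ e) _) ⟩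
  C * (suc a ^ e * suc n ^ e)       ≡⟨ *-assoc C _ _ ⟨
  C * suc a ^ e * suc n ^ e         ∎
  where
  open ≤-Reasoning
  ^-distribʳ-* : ∀ e m n → (m * n) ^ e ≡ m ^ e * n ^ e
  ^-distribʳ-* zero m n = refl
  ^-distribʳ-* (suc e) m n = trans (cong (m * n *_) (^-distribʳ-* e m n)) ([m*n]*[o*p]≡[m*o]*[n*p] m n _ _)

Bd-op : ∀ P → Bd k e f → Bd k e (⟦ P ⟧ f)
Bd-op (σ a) = Bd-σ a
Bd-op (κ c) = Bd-κ c
Bd-op (P ⊕ Q) p = Bd-+ (Bd-op P p) (Bd-op Q p)
Bd-op (P ⊖ Q) p = Bd-- (Bd-op P p) (Bd-op Q p)
Bd-op (P ⊙ Q) p = Bd-op P (Bd-op Q p)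

Bd-suc : Bd k e f → Bd (suc k) (suc e) f
Bd-suc {k} {e} {f} (bd C p) = bd C λ n → begin
  suc n * suc n ^ k * ∥ f n ∥      ≡⟨ *-assoc (suc n) (suc n ^ k) ∥ f n ∥ ⟩
  suc n * (suc n ^ k * ∥ f n ∥)    ≤⟨ *-monoʳ-≤ (suc n) (p n) ⟩
  suc n * (C * suc n ^ e)          ≡⟨ *-assoc (suc n) C _ ⟨
  suc n * C * suc n ^ e            ≡⟨ cong (_* suc n ^ e) (*-comm (suc n) C) ⟩
  C * suc n * suc n ^ e            ≡⟨ *-assoc C _ _ ⟩
  C * suc n ^ suc e                ∎
  where open ≤-Reasoning

Bd-weaken : Bd (suc k) e f → Bd k e f
Bd-weaken {k} (bd C p) = bd C λ n → ≤-trans (*-monoˡ-≤ _ (m≤n*m (suc n ^ k) (suc n))) (p n)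

-- Smallness modulo the ideal generated by differences

-- S^{x+y} - 1 = (S^x - 1) + S^x (S^y - 1).
D-closed-+ : ∀ f x y → Bd k e (⟦ D x ⟧ f) → Bd k e (⟦ D y ⟧ f) → Bd k e (⟦ D (x + y) ⟧ f)
D-closed-+ f x y p q = Bd-cong glue (Bd-+ p (Bd-σ x q))
  where
  telescope : ∀ u v w → (u ℤ.- v) ℤ.+ (w ℤ.- u) ≡ w ℤ.- v
  telescope = solve-∀
  glue : ∀ n → ⟦ D x ⟧ f n ℤ.+ ⟦ D y ⟧ f (x + n) ≡ ⟦ D (x + y) ⟧ f n
  glue n = trans (telescope (f (x + n)) (f n) (f (y + (x + n))))
    (cong (λ m → f m ℤ.- f n) (trans (sym (+-assoc y x n)) (cong (_+ n) (+-comm y x))))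

D-closed-* : ∀ f t x → Bd k e (⟦ D x ⟧ f) → Bd k e (⟦ D (t * x) ⟧ f)
D-closed-* f zero x p = Bd-cong (λ n → sym (ℤ.+-inverseʳ (f n))) (Bd-κ ℤ.0ℤ p)
D-closed-* f (suc t) x p = D-closed-+ f x (t * x) p (D-closed-* f t x p)

-- S^d - 1 = (S^{d+z} - 1) - S^d (S^z - 1), which avoids negative powers of S.
D-closed-∸ : ∀ f d z → Bd k e (⟦ D (d + z) ⟧ f) → Bd k e (⟦ D z ⟧ f) → Bd k e (⟦ D d ⟧ f)
D-closed-∸ f d z p q = Bd-cong glue (Bd-- p (Bd-σ d q))
  where
  telescope : ∀ u v w → (w ℤ.- v) ℤ.- (w ℤ.- u) ≡ u ℤ.- v
  telescope = solve-∀
  glue : ∀ n → ⟦ D (d + z) ⟧ f n ℤ.- ⟦ D z ⟧ f (d + n) ≡ ⟦ D d ⟧ f n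
  glue n = trans
    (cong (λ m → (f m ℤ.- f n) ℤ.- (f (z + (d + n)) ℤ.- f (d + n)))
      (trans (cong (_+ n) (+-comm d z)) (+-assoc z d n)))
    (telescope (f (d + n)) (f n) (f (z + (d + n))))

-- Bézout over ℕ writes the gcd as a difference of a multiple of one argument and a multiple of the
-- other; the two cases are the two orders.
D-closed-gcd : ∀ f x y → Bd k e (⟦ D x ⟧ f) → Bd k e (⟦ D y ⟧ f) → Bd k e (⟦ D (gcd x y) ⟧ f)
D-closed-gcd {k} {e} f x y p q with Bézout.identity (gcd-GCD x y)
... | Bézout.+- s t eq = D-closed-∸ f (gcd x y) (t * y)
  (subst (λ m → Bd k e (⟦ D m ⟧ f)) (sym eq) (D-closed-* f s x p)) (D-closed-* f t y q)
... | Bézout.-+ s t eq = D-closed-∸ f (gcd x y) (s * x)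
  (subst (λ m → Bd k e (⟦ D m ⟧ f)) (sym eq) (D-closed-* f t y q)) (D-closed-* f s x p)

-- P - P(1) is divisible by S - 1. For products, PQ - P(1)Q(1) = P(Q - Q(1)) + Q(1)(P - P(1)).
aug-approx : ∀ f P → Bd k e (⟦ Δ ⟧ f) → Bd k e (λ n → ⟦ P ⟧ f n ℤ.- aug P ℤ.* f n)
aug-approx {k} {e} f (σ a) p =
  Bd-cong (λ n → cong (ℤ._-_ (f (a + n))) (sym (ℤ.*-identityˡ (f n))))
    (subst (λ m → Bd k e (⟦ D m ⟧ f)) (*-identityʳ a) (D-closed-* f a 1 p))
aug-approx f (κ c) p =
  Bd-cong (λ n → sym (ℤ.+-inverseʳ (c ℤ.* f n))) (Bd-κ ℤ.0ℤ p)
aug-approx f (P ⊕ Q) p = Bd-cong (λ n → swap (⟦ P ⟧ f n) (aug P) (⟦ Q ⟧ f n) (aug Q) (f n))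
  (Bd-+ (aug-approx f P p) (aug-approx f Q p))
  where
  swap : ∀ u a v b w → (u ℤ.- a ℤ.* w) ℤ.+ (v ℤ.- b ℤ.* w) ≡ (u ℤ.+ v) ℤ.- (a ℤ.+ b) ℤ.* w
  swap = solve-∀
aug-approx f (P ⊖ Q) p = Bd-cong (λ n → swap (⟦ P ⟧ f n) (aug P) (⟦ Q ⟧ f n) (aug Q) (f n))
  (Bd-- (aug-approx f P p) (aug-approx f Q p))
  where
  swap : ∀ u a v b w → (u ℤ.- a ℤ.* w) ℤ.- (v ℤ.- b ℤ.* w) ≡ (u ℤ.- v) ℤ.- (a ℤ.- b) ℤ.* w
  swap = solve-∀
aug-approx f (P ⊙ Q) p =
  Bd-cong glue (Bd-+ (Bd-op P (aug-approx f Q p)) (Bd-κ (aug Q) (aug-approx f P p)))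
  where
  swap : ∀ u v a b w → (u ℤ.- b ℤ.* v) ℤ.+ b ℤ.* (v ℤ.- a ℤ.* w) ≡ u ℤ.- (a ℤ.* b) ℤ.* w
  swap = solve-∀
  glue : ∀ n → ⟦ P ⟧ (λ n → ⟦ Q ⟧ f n ℤ.- aug Q ℤ.* f n) n ℤ.+ aug Q ℤ.* (⟦ P ⟧ f n ℤ.- aug P ℤ.* f n)
    ≡ ⟦ P ⟧ (⟦ Q ⟧ f) n ℤ.- (aug P ℤ.* aug Q) ℤ.* f n
  glue n = trans
    (cong (λ x → x ℤ.+ aug Q ℤ.* (⟦ P ⟧ f n ℤ.- aug P ℤ.* f n))
      (trans (op-- P n) (cong (ℤ._-_ (⟦ P ⟧ (⟦ Q ⟧ f) n)) (op-κ P (aug Q) n))))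
    (swap (⟦ P ⟧ (⟦ Q ⟧ f) n) (⟦ P ⟧ f n) (aug P) (aug Q) (f n))

-- Summation along residue classes

sumTo-≥ : ∀ (u : ℕ → ℕ) {i} n → i ≤ n → u i ≤ sumTo u n
sumTo-≥ u zero z≤n = ≤-refl
sumTo-≥ u (suc n) i≤sn with m≤n⇒m<n∨m≡n i≤sn
... | inj₁ (s≤s i≤n) = ≤-trans (sumTo-≥ u n i≤n) (m≤m+n _ _)
... | inj₂ refl = m≤n+m _ (sumTo u n)

-- Any n beyond `m + a` is reached from n - a, which is still at least `m`; `1 ≤ a` makes the
-- descent well founded.
step-induction : ∀ {P : ℕ → Set} a m → 1 ≤ a → (∀ n → n ≤ m + a → P n) →
  (∀ n → m ≤ n → P n → P (a + n)) → ∀ n → P n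
step-induction {P} a m 1≤a base step = <-rec P go
  where
  go : ∀ n → (∀ {i} → i < n → P i) → P n
  go n ih with n ≤? m + a
  ... | yes n≤ = base n n≤
  ... | no n≰ = subst P (m+[n∸m]≡n a≤n) (step (n ∸ a) m≤ (ih (∸-monoʳ-< 1≤a a≤n)))
    where
    a≤n : a ≤ n
    a≤n = ≤-trans (m≤n+m a m) (<⇒≤ (≰⇒> n≰))
    m≤ : m ≤ n ∸ a
    m≤ = subst (_≤ n ∸ a) (m+n∸n≡m m a) (∸-monoˡ-≤ a (<⇒≤ (≰⇒> n≰)))

∣D∣-step : ∀ a (f : Seq) n → ∥ f (a + n) ∥ ≤ ∥ f n ∥ + ∥ ⟦ D a ⟧ f n ∥
∣D∣-step a f n = subst (λ x → ∥ x ∥ ≤ ∥ f n ∥ + ∥ ⟦ D a ⟧ f n ∥) (cancel (f n) (f (a + n)))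
  (ℤ.∣i+j∣≤∣i∣+∣j∣ (f n) (⟦ D a ⟧ f n))
  where
  cancel : ∀ x y → x ℤ.+ (y ℤ.- x) ≡ y
  cancel = solve-∀

-- For e = 0 a plain summation would only give a logarithmic bound; there D a f is eventually
-- zero by integrality, so f is eventually periodic.
integrate : ∀ f a → 1 ≤ a → Bd 1 e (⟦ D a ⟧ f) → Bd 0 e f
integrate {zero} f a 1≤a (bd C p) = bd K (step-induction a C 1≤a base step)
  where
  open ≤-Reasoning
  -- The sum serves as a crude maximum of |f| over the initial window.
  K = sumTo (∥_∥ ∘ f) (C + a)
  base : ∀ n → n ≤ C + a → 1 * ∥ f n ∥ ≤ K * 1
  base n n≤ = subst₂ _≤_ (sym (*-identityˡ _)) (sym (*-identityʳ K)) (sumTo-≥ (∥_∥ ∘ f) (C + a) n≤)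
  -- A nonzero integer has absolute value at least 1, which would force `suc n ≤ C`.
  vanish : ∀ n → C ≤ n → ∥ ⟦ D a ⟧ f n ∥ ≡ 0
  vanish n C≤n with ∥ ⟦ D a ⟧ f n ∥ | p n
  ... | zero | _ = refl
  ... | suc x | q = contradiction (begin-strict
    n                     <⟨ n<1+n n ⟩
    suc n                 ≡⟨ *-identityʳ (suc n) ⟨
    suc n ^ 1             ≤⟨ m≤m*n (suc n ^ 1) (suc x) ⟩
    suc n ^ 1 * suc x     ≤⟨ q ⟩
    C * 1                 ≡⟨ *-identityʳ C ⟩
    C                     ≤⟨ C≤n ⟩
    n                     ∎) (<-irrefl refl)
  step : ∀ n → C ≤ n → 1 * ∥ f n ∥ ≤ K * 1 → 1 * ∥ f (a + n) ∥ ≤ K * 1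
  step n C≤n ih = begin
    1 * ∥ f (a + n) ∥                ≡⟨ *-identityˡ _ ⟩
    ∥ f (a + n) ∥                    ≤⟨ ∣D∣-step a f n ⟩
    ∥ f n ∥ + ∥ ⟦ D a ⟧ f n ∥        ≡⟨ cong (λ x → ∥ f n ∥ + x) (vanish n C≤n) ⟩
    ∥ f n ∥ + 0                      ≡⟨⟩
    1 * ∥ f n ∥                      ≤⟨ ih ⟩
    K * 1                            ∎
integrate {suc e} f a 1≤a (bd C p) = bd K (step-induction a 0 1≤a base step)
  where
  open ≤-Reasoning
  -- The summand `C` lets `K` absorb the increments, the sum covers the initial window.
  K = C + sumTo (∥_∥ ∘ f) a
  base : ∀ n → n ≤ a → 1 * ∥ f n ∥ ≤ K * suc n ^ suc e
  base n n≤a = begin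
    1 * ∥ f n ∥             ≡⟨ *-identityˡ _ ⟩
    ∥ f n ∥                 ≤⟨ sumTo-≥ (∥_∥ ∘ f) a n≤a ⟩
    sumTo (∥_∥ ∘ f) a       ≤⟨ m≤n+m _ C ⟩
    K                       ≤⟨ m≤m*n K (suc n ^ suc e) {{m^n≢0 (suc n) (suc e)}} ⟩
    K * suc n ^ suc e       ∎
  increment : ∀ n → ∥ ⟦ D a ⟧ f n ∥ ≤ C * suc n ^ e
  increment n = *-cancelˡ-≤ (suc n) (begin
    suc n * ∥ ⟦ D a ⟧ f n ∥        ≡⟨ cong (λ m → m * ∥ ⟦ D a ⟧ f n ∥) (*-identityʳ (suc n)) ⟨
    suc n ^ 1 * ∥ ⟦ D a ⟧ f n ∥    ≤⟨ p n ⟩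
    C * (suc n * suc n ^ e)        ≡⟨ *-assoc C _ _ ⟨
    C * suc n * suc n ^ e          ≡⟨ cong (_* suc n ^ e) (*-comm C (suc n)) ⟩
    suc n * C * suc n ^ e          ≡⟨ *-assoc (suc n) C _ ⟩
    suc n * (C * suc n ^ e)        ∎)
  step : ∀ n → 0 ≤ n → 1 * ∥ f n ∥ ≤ K * suc n ^ suc e → 1 * ∥ f (a + n) ∥ ≤ K * suc (a + n) ^ suc e
  step n _ ih = begin
    1 * ∥ f (a + n) ∥                           ≡⟨ *-identityˡ _ ⟩
    ∥ f (a + n) ∥                               ≤⟨ ∣D∣-step a f n ⟩
    ∥ f n ∥ + ∥ ⟦ D a ⟧ f n ∥                   ≤⟨ +-mono-≤ (≤-trans (≤-reflexive (sym (*-identityˡ _))) ih) (increment n) ⟩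
    K * suc n ^ suc e + C * suc n ^ e           ≤⟨ +-monoʳ-≤ (K * suc n ^ suc e) (*-monoˡ-≤ (suc n ^ e) (m≤m+n C _)) ⟩
    K * suc n ^ suc e + K * suc n ^ e           ≡⟨ *-distribˡ-+ K _ _ ⟨
    -- With x = n + 1 this uses x^{e+1} + x^e = (x + 1)x^e ≤ (x + 1)^{e+1}, so the same `K` survives
    -- each step.
    K * (suc n ^ suc e + suc n ^ e)             ≡⟨ cong (K *_) (+-comm (suc n ^ suc e) _) ⟩
    K * (suc (suc n) * suc n ^ e)               ≤⟨ *-monoʳ-≤ K (*-monoʳ-≤ (suc (suc n)) (^-monoˡ-≤ e (n≤1+n (suc n)))) ⟩
    K * suc (suc n) ^ suc e                     ≤⟨ *-monoʳ-≤ K (^-monoˡ-≤ (suc e) (s≤s (+-monoˡ-≤ n 1≤a))) ⟩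
    K * suc (a + n) ^ suc e                     ∎

-- Regular variation with differences

pw : ℕ → Seq
pw e n = + (suc n ^ e)

Bd-zero : w ≗ (λ _ → ℤ.0ℤ) → Bd k e w
Bd-zero {k = k} vanish = bd 0 λ n → ≤-reflexive
  (trans (cong (λ x → suc n ^ k * ∥ x ∥) (vanish n)) (*-zeroʳ (suc n ^ k)))

Bd-pw : ∀ e → Bd 0 e (pw e)
Bd-pw e = bd 1 λ _ → ≤-refl

pw-suc : ∀ e n → pw (suc e) n ≡ + suc n ℤ.* pw e n
pw-suc e n = ℤ.pos-* (suc n) (suc n ^ e)

pw-+ : ∀ d e n → pw (d + e) n ≡ pw d n ℤ.* pw e n
pw-+ d e n = trans (cong +_ (^-distribˡ-+-* (suc n) d e)) (ℤ.pos-* (suc n ^ d) _)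

-- w(n) = c(n+1)^e + O(n^{e-1}); for e = 0 this means that w is eventually equal to c.
Asym : ℕ → ℤ → Seq → Set
Asym e c w = Bd 1 e (λ n → w n ℤ.- c ℤ.* pw e n)

-- Induction on the exponent: with x = n + 1, Δx^{e+2} - (e+2)x^{e+1} = (x+1)(Δx^{e+1} - (e+1)x^e) +
-- (e+1)x^e.
Δ-pw : ∀ e → Asym e (+ suc e) (⟦ Δ ⟧ (pw (suc e)))
Δ-pw zero = Bd-zero vanish
  where
  vanish : ∀ n → ⟦ Δ ⟧ (pw 1) n ℤ.- ℤ.1ℤ ℤ.* pw 0 n ≡ ℤ.0ℤ
  vanish n = trans (cong₂ (λ x y → + x ℤ.- + y ℤ.- ℤ.1ℤ) (*-identityʳ (suc (suc n))) (*-identityʳ (suc n)))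
    (cancel (+ suc n))
    where
    cancel : ∀ x → ℤ.1ℤ ℤ.+ x ℤ.- x ℤ.- ℤ.1ℤ ≡ ℤ.0ℤ
    cancel = solve-∀
Δ-pw (suc e) = Bd-cong glue
  (Bd-+ (Bd-* Bd-shifted (Δ-pw e)) (Bd-suc (Bd-κ (+ suc e) (Bd-pw e))))
  where
  Bd-shifted : Bd 0 1 (λ n → + suc (suc n))
  Bd-shifted = Bd-cong (λ n → cong +_ (*-identityʳ (suc (suc n)))) (Bd-σ 1 (Bd-pw 1))
  expand : ∀ x y z s → (ℤ.1ℤ ℤ.+ x) ℤ.* ((ℤ.1ℤ ℤ.+ x) ℤ.* y ℤ.- x ℤ.* z ℤ.- s ℤ.* z) ℤ.+ s ℤ.* z
    ≡ (ℤ.1ℤ ℤ.+ x) ℤ.* ((ℤ.1ℤ ℤ.+ x) ℤ.* y) ℤ.- x ℤ.* (x ℤ.* z) ℤ.- (ℤ.1ℤ ℤ.+ s) ℤ.* (x ℤ.* z)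
  expand = solve-∀
  glue : ∀ n → + suc (suc n) ℤ.* (⟦ Δ ⟧ (pw (suc e)) n ℤ.- + suc e ℤ.* pw e n) ℤ.+ + suc e ℤ.* pw e n
    ≡ ⟦ Δ ⟧ (pw (suc (suc e))) n ℤ.- + suc (suc e) ℤ.* pw (suc e) n
  glue n = trans
    (cong₂ (λ y z → + suc (suc n) ℤ.* (y ℤ.- z ℤ.- + suc e ℤ.* pw e n) ℤ.+ + suc e ℤ.* pw e n)
      (pw-suc e (suc n)) (pw-suc e n))
    (trans (expand (+ suc n) (pw e (suc n)) (pw e n) (+ suc e))
      (sym (trans
        (cong₂ (λ y z → y ℤ.- z ℤ.- + suc (suc e) ℤ.* pw (suc e) n)
          (pw-suc (suc e) (suc n)) (pw-suc (suc e) n))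
        (cong₂ (λ y z → + suc (suc n) ℤ.* y ℤ.- + suc n ℤ.* z ℤ.- + suc (suc e) ℤ.* z)
          (pw-suc e (suc n)) (pw-suc e n)))))

-- Regular variation together with m differences: Δⁱ w(n) ~ c·d(d−1)⋯(d−i+1)·n^{d−i} for all
-- i ≤ m.  Only i = m is recorded, the smaller i follow by summation (see S-lower).
S : ℕ → ℕ → ℤ → Seq → Set
S zero d c w = Asym d c w
S (suc m) zero c w = Empty
S (suc m) (suc d) c w = S m d (+ suc d ℤ.* c) (⟦ Δ ⟧ w)

S-cong : ∀ m d → w ≗ v → S m d c w → S m d c v
S-cong {c = c} zero d eq p = Bd-cong (λ n → cong (ℤ._- c ℤ.* pw d n) (eq n)) p
S-cong (suc m) (suc d) eq p = S-cong m d (op-cong Δ eq) p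

S-coef : ∀ m d w → c ≡ c′ → S m d c w → S m d c′ w
S-coef m d w eq = subst (λ c → S m d c w) eq

-- In the base case `Δ-pw` shows that Δ(w - c(n+1)^{d+1}) = O(n^{d-1}), and `integrate` sums this to
-- O(n^d).
S-lower : ∀ m d → S (suc m) d c w → S m d c w
S-lower {c} {w} zero (suc d) p =
  Bd-suc (integrate _ 1 (s≤s z≤n) (Bd-cong glue (Bd-- p (Bd-κ c (Δ-pw d)))))
  where
  expand : ∀ u v c x y z s →
    (u ℤ.- v ℤ.- s ℤ.* c ℤ.* x) ℤ.- c ℤ.* (y ℤ.- z ℤ.- s ℤ.* x) ≡ (u ℤ.- c ℤ.* y) ℤ.- (v ℤ.- c ℤ.* z)
  expand = solve-∀
  glue : ∀ n → (⟦ Δ ⟧ w n ℤ.- + suc d ℤ.* c ℤ.* pw d n)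
      ℤ.- c ℤ.* (⟦ Δ ⟧ (pw (suc d)) n ℤ.- + suc d ℤ.* pw d n)
    ≡ ⟦ Δ ⟧ (λ n → w n ℤ.- c ℤ.* pw (suc d) n) n
  glue n = expand (w (suc n)) (w n) c (pw d n) (pw (suc d) (suc n)) (pw (suc d) n) (+ suc d)
S-lower (suc m) (suc d) p = S-lower m d p

S-asym : ∀ m d → S m d c w → Asym d c w
S-asym zero d p = p
S-asym (suc m) d p = S-asym m d (S-lower m d p)

S-weaken : ∀ k m d → S (k + m) d c w → S m d c w
S-weaken zero m d p = p
S-weaken (suc k) m d p = S-weaken k m d (S-lower (k + m) d p)

-- Seen from one degree higher, the leading term is itself an error term. This admits lower-order
-- summands in `S-*`.
S-lift : ∀ m d → S m d c w → S m (suc d) ℤ.0ℤ w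
S-lift {c} {w} zero d p = Bd-cong glue (Bd-suc (Bd-+ (Bd-weaken p) (Bd-κ c (Bd-pw d))))
  where
  cancel : ∀ x y → (x ℤ.- y) ℤ.+ y ≡ x ℤ.- ℤ.0ℤ
  cancel = solve-∀
  glue : ∀ n → (w n ℤ.- c ℤ.* pw d n) ℤ.+ c ℤ.* pw d n ≡ w n ℤ.- ℤ.0ℤ ℤ.* pw (suc d) n
  glue n = cancel (w n) (c ℤ.* pw d n)
S-lift {w = w} (suc m) (suc d) p =
  S-coef m (suc d) (⟦ Δ ⟧ w) (sym (ℤ.*-zeroʳ (+ suc (suc d)))) (S-lift m d p)

S-+ : ∀ m d → S m d c w → S m d c′ v → S m d (c ℤ.+ c′) (λ n → w n ℤ.+ v n)
S-+ {c} {w} {c′} {v} zero d p q =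
  Bd-cong (λ n → expand (w n) (v n) c c′ (pw d n)) (Bd-+ p q)
  where
  expand : ∀ x y c c′ z → (x ℤ.- c ℤ.* z) ℤ.+ (y ℤ.- c′ ℤ.* z) ≡ (x ℤ.+ y) ℤ.- (c ℤ.+ c′) ℤ.* z
  expand = solve-∀
S-+ {c} {w} {c′} {v} (suc m) (suc d) p q =
  S-coef m d (⟦ Δ ⟧ (λ n → w n ℤ.+ v n)) (sym (ℤ.*-distribˡ-+ (+ suc d) c c′))
    (S-cong m d (λ n → sym (op-+ {w} {v} Δ n)) (S-+ m d p q))

S-κ : ∀ m d b → S m d c w → S m d (b ℤ.* c) (⟦ κ b ⟧ w)
S-κ {c} {w} zero d b p = Bd-cong (λ n → expand b c (w n) (pw d n)) (Bd-κ b p)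
  where
  expand : ∀ b c x z → b ℤ.* (x ℤ.- c ℤ.* z) ≡ b ℤ.* x ℤ.- b ℤ.* c ℤ.* z
  expand = solve-∀
S-κ {c} {w} (suc m) (suc d) b p =
  S-coef m d (⟦ Δ ⟧ (⟦ κ b ⟧ w)) (swap b (+ suc d) c)
    (S-cong m d (λ n → sym (op-κ {w} Δ b n)) (S-κ m d b p))
  where
  swap : ∀ x y z → x ℤ.* (y ℤ.* z) ≡ y ℤ.* (x ℤ.* z)
  swap = solve-∀

-- Leibniz rule Δ(wv) = Δw·v + (w + Δw)·Δv. Inside w + Δw the second summand has lower degree and
-- contributes the coefficient 0.
S-* : ∀ m d d′ → S m d c w → S m d′ c′ v → S m (d + d′) (c ℤ.* c′) (λ n → w n ℤ.* v n)
S-* {c} {w} {c′} {v} zero d d′ p q =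
  Bd-cong glue (Bd-+ (Bd-* p Bd-v) (Bd-* (Bd-κ c (Bd-pw d)) q))
  where
  Bd-v : Bd 0 d′ v
  Bd-v = Bd-cong (λ n → cancel (v n) (c′ ℤ.* pw d′ n)) (Bd-+ (Bd-weaken q) (Bd-κ c′ (Bd-pw d′)))
    where
    cancel : ∀ x y → (x ℤ.- y) ℤ.+ y ≡ x
    cancel = solve-∀
  expand : ∀ w v c c′ x y →
    (w ℤ.- c ℤ.* x) ℤ.* v ℤ.+ c ℤ.* x ℤ.* (v ℤ.- c′ ℤ.* y) ≡ w ℤ.* v ℤ.- c ℤ.* c′ ℤ.* (x ℤ.* y)
  expand = solve-∀
  glue : ∀ n → (w n ℤ.- c ℤ.* pw d n) ℤ.* v n ℤ.+ c ℤ.* pw d n ℤ.* (v n ℤ.- c′ ℤ.* pw d′ n)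
    ≡ w n ℤ.* v n ℤ.- c ℤ.* c′ ℤ.* pw (d + d′) n
  glue n = trans (expand (w n) (v n) c c′ (pw d n) (pw d′ n))
    (cong (λ x → w n ℤ.* v n ℤ.- c ℤ.* c′ ℤ.* x) (sym (pw-+ d d′ n)))
S-* {c} {w} {c′} {v} (suc m) (suc d) (suc d′) p q =
  S-coef m (d + suc d′) (⟦ Δ ⟧ (λ n → w n ℤ.* v n)) (coef (+ suc d) (+ suc d′) c c′)
    (S-cong m (d + suc d′) leibniz (S-+ m (d + suc d′) left right))
  where
  left : S m (d + suc d′) (+ suc d ℤ.* c ℤ.* c′) (λ n → ⟦ Δ ⟧ w n ℤ.* v n)
  left = S-* m d (suc d′) p (S-lower m (suc d′) q)
  shifted : S m (suc d) (c ℤ.+ ℤ.0ℤ) (λ n → w n ℤ.+ ⟦ Δ ⟧ w n)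
  shifted = S-+ {w = w} m (suc d) (S-lower m (suc d) p) (S-lift {w = ⟦ Δ ⟧ w} m d p)
  right : S m (d + suc d′) ((c ℤ.+ ℤ.0ℤ) ℤ.* (+ suc d′ ℤ.* c′))
    (λ n → (w n ℤ.+ ⟦ Δ ⟧ w n) ℤ.* ⟦ Δ ⟧ v n)
  right = subst (λ e → S m e ((c ℤ.+ ℤ.0ℤ) ℤ.* (+ suc d′ ℤ.* c′)) (λ n → (w n ℤ.+ ⟦ Δ ⟧ w n) ℤ.* ⟦ Δ ⟧ v n))
    (sym (+-suc d d′))
    (S-* m (suc d) d′ shifted q)
  product-rule : ∀ w w′ v v′ →
    (w′ ℤ.- w) ℤ.* v ℤ.+ (w ℤ.+ (w′ ℤ.- w)) ℤ.* (v′ ℤ.- v) ≡ w′ ℤ.* v′ ℤ.- w ℤ.* v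
  product-rule = solve-∀
  leibniz : ∀ n → ⟦ Δ ⟧ w n ℤ.* v n ℤ.+ (w n ℤ.+ ⟦ Δ ⟧ w n) ℤ.* ⟦ Δ ⟧ v n
    ≡ ⟦ Δ ⟧ (λ n → w n ℤ.* v n) n
  leibniz n = product-rule (w n) (w (suc n)) (v n) (v (suc n))
  coef : ∀ s s′ c c′ →
    s ℤ.* c ℤ.* c′ ℤ.+ (c ℤ.+ ℤ.0ℤ) ℤ.* (s′ ℤ.* c′) ≡ (s ℤ.+ s′) ℤ.* (c ℤ.* c′)
  coef = solve-∀

-- L w = (Δw)² - w·Δ²w. With D = d + 2 the leading coefficients are D²c² and D(D-1)c², whose
-- difference Dc² does not cancel; two differences are spent.
S-L : ∀ m d → S (2 + m) (2 + d) c w → S m (2 + (d + d)) (+ (2 + d) ℤ.* (c ℤ.* c)) (L w)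
S-L {c} {w} m d p = S-coef m _ (L w) (coef (+ suc d) c)
  (S-cong m _ expand-L (S-+ m _ square (S-κ m _ ℤ.-1ℤ cross)))
  where
  c₁ c₂ : ℤ
  c₁ = + (2 + d) ℤ.* c
  c₂ = + (1 + d) ℤ.* c₁
  Δw ΔΔw : Seq
  Δw = ⟦ Δ ⟧ w
  ΔΔw = ⟦ Δ ⟧ Δw
  Δw∈ : S m (suc d) c₁ Δw
  Δw∈ = S-lower m (suc d) p
  square : S m (2 + (d + d)) (c₁ ℤ.* c₁) (λ n → Δw n ℤ.* Δw n)
  square = subst (λ e → S m e (c₁ ℤ.* c₁) (λ n → Δw n ℤ.* Δw n)) (cong suc (+-suc d d))
    (S-* m (suc d) (suc d) Δw∈ Δw∈)
  cross : S m (2 + (d + d)) (c ℤ.* c₂) (λ n → w n ℤ.* ΔΔw n)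
  cross = S-* {w = w} m (2 + d) d (S-weaken 2 m (2 + d) p) p
  identity : ∀ x y z → (y ℤ.- x) ℤ.* (y ℤ.- x) ℤ.+ ℤ.-1ℤ ℤ.* (x ℤ.* ((z ℤ.- y) ℤ.- (y ℤ.- x)))
    ≡ y ℤ.* y ℤ.- x ℤ.* z
  identity = solve-∀
  expand-L : ∀ n → Δw n ℤ.* Δw n ℤ.+ ℤ.-1ℤ ℤ.* (w n ℤ.* ΔΔw n) ≡ L w n
  expand-L n = identity (w n) (w (1 + n)) (w (2 + n))
  coef : ∀ b c → (ℤ.1ℤ ℤ.+ b) ℤ.* c ℤ.* ((ℤ.1ℤ ℤ.+ b) ℤ.* c)
      ℤ.+ ℤ.-1ℤ ℤ.* (c ℤ.* (b ℤ.* ((ℤ.1ℤ ℤ.+ b) ℤ.* c)))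
    ≡ (ℤ.1ℤ ℤ.+ b) ℤ.* (c ℤ.* c)
  coef = solve-∀

-- Positivity under iterated `L`, and rescaling

EventuallyPositive : Seq → Set
EventuallyPositive w = ∃ λ N → ∀ i → N ≤ i → ℤ.0ℤ ℤ.< w i

∣z-y∣≥y : ∀ z y → ¬ (ℤ.0ℤ ℤ.< z) → y ≤ ∥ z ℤ.- + y ∥
∣z-y∣≥y (+ suc x) y z≯0 = contradiction (+<+ (s≤s z≤n)) z≯0
∣z-y∣≥y (+ zero) zero z≯0 = z≤n
∣z-y∣≥y (+ zero) (suc y) z≯0 = ≤-refl
∣z-y∣≥y -[1+ x ] zero z≯0 = z≤n
∣z-y∣≥y -[1+ x ] (suc y) z≯0 = s≤s (m≤n⇒m≤1+n (m≤n+m y x))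

-- If w(i) ≤ 0, then the error is at least (i+1)^d, whereas i + 1 times the error is at most
-- C(i+1)^d. This fails from i = C on.
S-positive : ∀ m d → ℤ.0ℤ ℤ.< c → S m d c w → EventuallyPositive w
S-positive {+ zero} m d (+<+ ()) p
S-positive {+ suc b} {w} m d 0<c p with S-asym m d p
... | bd C bound = C , positive
  where
  positive : ∀ i → C ≤ i → ℤ.0ℤ ℤ.< w i
  positive i C≤i with ℤ.0ℤ ℤ.<? w i
  ... | yes 0<wi = 0<wi
  ... | no 0≮wi = contradiction (*-cancelʳ-≤ (suc i) C N^d {{m^n≢0 (suc i) d}} (begin
    suc i * N^d                                  ≤⟨ *-monoʳ-≤ (suc i) (m≤n*m N^d (suc b)) ⟩
    suc i * (suc b * N^d)                        ≤⟨ *-monoʳ-≤ (suc i) (∣z-y∣≥y (w i) (suc b * N^d) 0≮wi) ⟩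
    suc i * ∥ w i ℤ.- + (suc b * N^d) ∥
      ≡⟨ cong₂ (λ s y → s * ∥ w i ℤ.- y ∥) (sym (*-identityʳ (suc i))) (ℤ.pos-* (suc b) N^d) ⟩
    suc i ^ 1 * ∥ w i ℤ.- + suc b ℤ.* pw d i ∥   ≤⟨ bound i ⟩
    C * N^d                                      ∎)) (<⇒≱ (s≤s C≤i))
    where
    open ≤-Reasoning
    N^d : ℕ
    N^d = suc i ^ d

-- `L^` adds `L` on the outside, while the induction below applies `S-L` to the innermost sequence.
L^-L : ∀ j w → L^ j (L w) ≡ L (L^ j w)
L^-L zero w = refl
L^-L (suc j) w = cong L (L^-L j w)

S-L^-positive : ∀ r d → ℤ.0ℤ ℤ.< c → S (r * 2) d c w →
  ∃ λ N → ∀ j → j ≤ r → ∀ i → N ≤ i → ℤ.0ℤ ℤ.< L^ j w i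
S-L^-positive zero d 0<c p with S-positive 0 d 0<c p
... | N , pos = N , λ { zero _ → pos }
S-L^-positive {+ zero} (suc r) d (+<+ ())
-- `S` is empty when there are more differences than the degree, so d ≥ 2 here. Matching `c` as a
-- positive literal lets the new coefficient compute to one.
S-L^-positive {c@(+ suc _)} {w} (suc r) (suc (suc d)) 0<c p
  with S-positive (2 + r * 2) (2 + d) 0<c p | S-L^-positive r _ (+<+ (s≤s z≤n)) (S-L {c} {w} (r * 2) d p)
... | N , pos | N′ , pos′ = N ⊔ N′ , both
  where
  both : ∀ j → j ≤ suc r → ∀ i → N ⊔ N′ ≤ i → ℤ.0ℤ ℤ.< L^ j w i
  both zero _ i N≤i = pos i (≤-trans (m≤m⊔n N N′) N≤i)
  both (suc j) (s≤s j≤r) i N≤i =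
    subst (λ u → ℤ.0ℤ ℤ.< u i) (L^-L j w) (pos′ j j≤r i (≤-trans (m≤n⊔m N N′) N≤i))

L-cong : w ≗ v → L w ≗ L v
L-cong eq i = cong₂ ℤ._-_ (cong₂ ℤ._*_ (eq (suc i)) (eq (suc i))) (cong₂ ℤ._*_ (eq i) (eq (suc (suc i))))

L-κ : ∀ b w → L (⟦ κ b ⟧ w) ≗ ⟦ κ (b ℤ.* b) ⟧ (L w)
L-κ b w i = expand b (w i) (w (suc i)) (w (suc (suc i)))
  where
  expand : ∀ b x y z → b ℤ.* y ℤ.* (b ℤ.* y) ℤ.- b ℤ.* x ℤ.* (b ℤ.* z) ≡ b ℤ.* b ℤ.* (y ℤ.* y ℤ.- x ℤ.* z)
  expand = solve-∀

L^-κ : ∀ j b w → ∃ λ μ → L^ j (⟦ κ b ⟧ w) ≗ ⟦ κ μ ⟧ (L^ j w)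
L^-κ zero b w = b , λ _ → refl
L^-κ (suc j) b w with L^-κ j b w
... | μ , eq = μ ℤ.* μ , λ i → trans (L-cong eq i) (L-κ μ (L^ j w) i)

*-square-pos : ∀ μ x → ℤ.0ℤ ℤ.< μ ℤ.* μ ℤ.* x → ℤ.0ℤ ℤ.< x
*-square-pos μ x 0<μμx = ℤ.*-cancelˡ-<-nonNeg (+ (∥ μ ∥ * ∥ μ ∥))
  (subst₂ ℤ._<_ (sym (ℤ.*-zeroʳ (+ (∥ μ ∥ * ∥ μ ∥)))) (cong (ℤ._* x) (square μ)) 0<μμx)
  where
  square : ∀ μ → μ ℤ.* μ ≡ + (∥ μ ∥ * ∥ μ ∥)
  square (+ n) = sym (ℤ.pos-* n n)
  square -[1+ n ] = refl

-- `L` is homogeneous of degree 2, so after one application the scale factor is a square. Positivity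
-- therefore transfers back whatever the sign of `b`.
L^-unscale : ∀ j b w i → ℤ.0ℤ ℤ.< L^ (suc j) (⟦ κ b ⟧ w) i → ℤ.0ℤ ℤ.< L^ (suc j) w i
L^-unscale j b w i pos with L^-κ j b w
... | μ , eq = *-square-pos μ (L^ (suc j) w i)
  (subst (ℤ.0ℤ ℤ.<_) (trans (L-cong eq i) (L-κ μ (L^ j w) i)) pos)

-- Cancelling one factor of the generating function

geom-∣ : ∀ {a n} → a ∣ n → geom a n ≡ 1
geom-∣ {a} {n} a∣n = cong (λ b → if b then 1 else 0) (dec-true (a ∣? n) a∣n)

geom-∤ : ∀ {a n} → ¬ (a ∣ n) → geom a n ≡ 0
geom-∤ {a} {n} a∤n = cong (λ b → if b then 1 else 0) (dec-false (a ∣? n) a∤n)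

geom-periodic : ∀ a n → geom a (a + n) ≡ geom a n
geom-periodic a n with a ∣? n
... | yes a∣n = geom-∣ (∣m∣n⇒∣m+n ∣-refl a∣n)
... | no a∤n = geom-∤ λ a∣a+n → a∤n (∣m+n∣m⇒∣n a∣a+n ∣-refl)

sumTo-cong : ∀ {u v : ℕ → ℕ} n → (∀ i → i ≤ n → u i ≡ v i) → sumTo u n ≡ sumTo v n
sumTo-cong zero eq = eq 0 z≤n
sumTo-cong (suc n) eq =
  cong₂ _+_ (sumTo-cong n λ i i≤n → eq i (m≤n⇒m≤1+n i≤n)) (eq (suc n) ≤-refl)

sumTo-vanish : ∀ (u : ℕ → ℕ) n t → (∀ i → n < i → i ≤ t + n → u i ≡ 0) → sumTo u (t + n) ≡ sumTo u n
sumTo-vanish u n zero eq = refl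
sumTo-vanish u n (suc t) eq = trans
  (cong₂ _+_ (sumTo-vanish u n t λ i n<i i≤ → eq i n<i (m≤n⇒m≤1+n i≤))
    (eq (suc (t + n)) (s≤s (m≤n+m n t)) ≤-refl))
  (+-identityʳ (sumTo u n))

-- Coefficient form of (1 - x^a)·u/(1 - x^a) = u. Indices i ≤ n give the convolution at n by
-- periodicity, those strictly between n and a + n vanish since 0 < a + n - i < a, and i = a + n
-- gives the new term.
⊛-geom-step : ∀ u a n → 1 ≤ a → (u ⊛ geom a) (a + n) ≡ (u ⊛ geom a) n + u (a + n)
⊛-geom-step u a@(suc b) n _ = cong₂ _+_ (trans (sumTo-vanish h n b gap) (sumTo-cong n shift)) last
  where
  h : ℕ → ℕ
  h i = u i * geom a (a + n ∸ i)
  gap : ∀ i → n < i → i ≤ b + n → h i ≡ 0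
  gap i n<i i≤ = trans
    (cong (u i *_) (geom-∤ (>⇒∤ {{>-nonZero (m<n⇒0<n∸m (s≤s i≤))}} below)))
    (*-zeroʳ (u i))
    where
    below : a + n ∸ i < a
    below = +-cancelʳ-< i (a + n ∸ i) a
      (subst (_< a + i) (sym (m∸n+n≡m (m≤n⇒m≤1+n i≤))) (+-monoʳ-< a n<i))
  shift : ∀ i → i ≤ n → h i ≡ u i * geom a (n ∸ i)
  shift i i≤n = cong (u i *_) (trans (cong (geom a) (+-∸-assoc a i≤n)) (geom-periodic a (n ∸ i)))
  last : h (a + n) ≡ u (a + n)
  last = trans (cong (u (a + n) *_) (trans (cong (geom a) (n∸n≡0 (a + n))) (geom-∣ (a ∣0))))
    (*-identityʳ (u (a + n)))

pℤ : (ℕ → ℕ) → ℕ → Seq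
pℤ a k n = + pA a k n

D-p : ∀ a k → 1 ≤ a k → ⟦ D (a k) ⟧ (pℤ a (suc k)) ≗ ⟦ σ (a k) ⟧ (pℤ a k)
D-p a k 1≤ak n = trans
  (cong (λ x → + x ℤ.- pℤ a (suc k) n) (⊛-geom-step (pA a k) (a k) n 1≤ak))
  (cancel (pℤ a (suc k) n) (pℤ a k (a k + n)))
  where
  cancel : ∀ x y → x ℤ.+ y ℤ.- x ≡ y
  cancel = solve-∀

-- Products of differences over index sets, and gcds

-- The product of S^{a_i} - 1 over i ∈ I.
DI : (ℕ → ℕ) → Subset k → Op
DI a [] = σ 0
DI a (inside ∷ I) = D (a 0) ⊙ DI (a ∘ suc) I
DI a (outside ∷ I) = DI (a ∘ suc) I

DI-insert : ∀ a (i : Fin k) I → i ∉ I →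
  ⟦ D (a (toℕ i)) ⟧ (⟦ DI a I ⟧ f) ≗ ⟦ DI a (I [ i ]≔ inside) ⟧ f
DI-insert a zero (inside ∷ I) i∉I = contradiction here i∉I
DI-insert a zero (outside ∷ I) i∉I n = refl
DI-insert {f = f} a (suc i) (inside ∷ I) i∉I n = trans
  (op-comm {⟦ DI (a ∘ suc) I ⟧ f} (D (a (suc (toℕ i)))) (D (a 0)) n)
  (op-cong (D (a 0)) (DI-insert (a ∘ suc) i I (i∉I ∘ there)) n)
DI-insert a (suc i) (outside ∷ I) i∉I = DI-insert (a ∘ suc) i I (i∉I ∘ there)

∣insert∣ : ∀ (i : Fin k) I → i ∉ I → ∣ I [ i ]≔ inside ∣ ≡ suc ∣ I ∣
∣insert∣ zero (inside ∷ I) i∉I = contradiction here i∉I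
∣insert∣ zero (outside ∷ I) i∉I = refl
∣insert∣ (suc i) (inside ∷ I) i∉I = cong suc (∣insert∣ i I (i∉I ∘ there))
∣insert∣ (suc i) (outside ∷ I) i∉I = ∣insert∣ i I (i∉I ∘ there)

∃-∉ : ∀ (I : Subset k) → ∣ I ∣ < k → ∃ λ i → i ∉ I
∃-∉ (outside ∷ I) _ = zero , λ ()
∃-∉ (inside ∷ I) (s≤s lt) with ∃-∉ I lt
... | i , i∉I = suc i , λ { (there i∈I) → i∉I i∈I }

shrink : ∀ n (K : Subset k) → n ≤ ∣ K ∣ → ∃ λ J → ∣ J ∣ ≡ n × J ⊆ K
shrink {k} zero K _ = ⊥ , ∣⊥∣≡0 k , ⊥⊆
shrink (suc n) (outside ∷ K) n≤ with shrink (suc n) K n≤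
... | J , eq , J⊆K = outside ∷ J , eq , out⊆ J⊆K
shrink (suc n) (inside ∷ K) (s≤s n≤) with shrink n K n≤
... | J , eq , J⊆K = inside ∷ J , cong suc eq , s⊆s J⊆K

-- The recursion inside gcdSub is a local function without an accessible name, so gcdOver is
-- obtained by unification.
mutual
  gcdOver : (Fin k → ℕ) → Subset k → List (Fin k) → ℕ
  gcdOver = _

  gcdOver-allFin : ∀ (b : Fin k → ℕ) I → gcdOver b I (allFin k) ≡ gcdSub b I
  gcdOver-allFin {k} b I with allFin k
  ... | is = refl

-- Meant for the set of b for which S^b - 1 makes a given sequence small.
gcdSub-closed : ∀ (P : ℕ → Set) → P 0 → (∀ x y → P x → P y → P (gcd x y)) →
  (b : Fin k → ℕ) (I : Subset k) → (∀ i → i ∈ I → P (b i)) → P (gcdSub b I)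
gcdSub-closed {k} P P0 Pgcd b I Pb = subst P (gcdOver-allFin b I) (over (allFin k))
  where
  over : ∀ is → P (gcdOver b I is)
  over []ᴸ = P0
  over (i ∷ᴸ is) with i ∈? I
  ... | yes i∈I = Pgcd (b i) _ (Pb i i∈I) (over is)
  ... | no _ = over is

-- `DI` recurses from the first index but `pA` from the last; the last difference must act first in
-- order to cancel.
DI-⊤-snoc : ∀ k a → ⟦ DI a (⊤ {suc k}) ⟧ f ≗ ⟦ DI a (⊤ {k}) ⟧ (⟦ D (a k) ⟧ f)
DI-⊤-snoc zero a n = refl
DI-⊤-snoc {f} (suc k) a = op-cong (D (a 0)) (DI-⊤-snoc k (a ∘ suc))

Boxes : (ℕ → ℕ) → ℕ → Op
Boxes a zero = σ 0
Boxes a (suc k) = Boxes a k ⊙ Box (a k)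

Box-positive : ∀ b f → 1 ≤ b → (∀ n → ℤ.0ℤ ℤ.≤ f n) → ℤ.0ℤ ℤ.< f 0 → ℤ.0ℤ ℤ.< ⟦ Box b ⟧ f 0
Box-positive (suc zero) f _ 0≤f 0<f0 = ℤ.+-mono-≤-< (ℤ.≤-reflexive (sym (ℤ.*-zeroˡ (f 0)))) 0<f0
Box-positive (suc (suc b)) f _ 0≤f 0<f0 =
  ℤ.+-mono-<-≤ (Box-positive (suc b) f (s≤s z≤n) 0≤f 0<f0) (0≤f (suc b + 0))

Δ≗0⇒const : ⟦ Δ ⟧ f ≗ (λ _ → ℤ.0ℤ) → ∀ n → f n ≡ f 0
Δ≗0⇒const eq zero = refl
Δ≗0⇒const {f} eq (suc n) = trans (ℤ.i-j≡0⇒i≡j (f (suc n)) (f n) (eq n)) (Δ≗0⇒const {f} eq n)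

-- The d-th difference of a sequence with leading term c n^d is d!·c; hence the factor d! that
-- `p-smooth` introduces.
S-from-Δ^const : ∀ d {c f} → (∀ n → ⟦ Δ^ d ⟧ f n ≡ + (d !) ℤ.* c) → S d d c f
S-from-Δ^const zero {c} {f} eq = Bd-zero λ n → trans (cong (ℤ._- c ℤ.* ℤ.1ℤ) (eq n)) (cancel c)
  where
  cancel : ∀ c → ℤ.1ℤ ℤ.* c ℤ.- c ℤ.* ℤ.1ℤ ≡ ℤ.0ℤ
  cancel = solve-∀
S-from-Δ^const (suc d) {c} eq = S-from-Δ^const d λ n → trans (eq n)
  (trans (cong (ℤ._* c) (ℤ.pos-* (suc d) (d !))) (swap (+ suc d) (+ (d !)) c))
  where
  swap : ∀ x y z → x ℤ.* y ℤ.* z ≡ y ℤ.* (x ℤ.* z)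
  swap = solve-∀

S-from-Δ^small : ∀ m d {f} → m ≤ d → Bd 1 (d ∸ m) (⟦ Δ^ m ⟧ f) → S m d ℤ.0ℤ f
S-from-Δ^small zero d {f} _ small = Bd-cong (λ n → sym (cancel (f n) (pw d n))) small
  where
  cancel : ∀ x y → x ℤ.- ℤ.0ℤ ℤ.* y ≡ x
  cancel = solve-∀
S-from-Δ^small (suc m) (suc d) {f} (s≤s m≤d) small =
  S-coef m d (⟦ Δ ⟧ f) (sym (ℤ.*-zeroʳ (+ suc d))) (S-from-Δ^small m d m≤d small)

DI-⊥ : ∀ k a → ⟦ DI a (⊥ {k}) ⟧ f ≗ f
DI-⊥ zero a n = refl
DI-⊥ (suc k) a = DI-⊥ k (a ∘ suc)

-- Growth of the differences of the partition function

module _ (a : ℕ → ℕ) (1≤a : ∀ i → 1 ≤ a i) where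

  -- Each `Δ` pairs with one `Box` to form S^{a_i} - 1, which cancels a factor up to a shift. What
  -- remains is `Box (a 0)` on 1/(1 - x^{a_0}), a constant, positive because the coefficient at 0 is
  -- 1.
  Δ-Boxes-p : ∀ d → ∃ λ c → ℤ.0ℤ ℤ.< c × ∀ n → ⟦ Δ^ d ⟧ (⟦ Boxes a (suc d) ⟧ (pℤ a (suc d))) n ≡ c
  Δ-Boxes-p zero = ⟦ Box (a 0) ⟧ (pℤ a 1) 0 , positive , Δ≗0⇒const {⟦ Box (a 0) ⟧ (pℤ a 1)} λ n →
    trans (Δ-Box (a 0) n) (trans (D-p a 0 (1≤a 0) n) (one-vanish (a 0) n (1≤a 0)))
    where
    one-vanish : ∀ b n → 1 ≤ b → + one (b + n) ≡ ℤ.0ℤ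
    one-vanish (suc b) n _ = refl
    positive : ℤ.0ℤ ℤ.< ⟦ Box (a 0) ⟧ (pℤ a 1) 0
    positive = Box-positive (a 0) (pℤ a 1) (1≤a 0) (λ _ → +≤+ z≤n)
      (subst (λ x → ℤ.0ℤ ℤ.< + (1 * x)) (sym (geom-∣ (a 0 ∣0))) (+<+ (s≤s z≤n)))
  Δ-Boxes-p (suc d) with Δ-Boxes-p d
  ... | c , 0<c , eq = c , 0<c , λ n → begin
    ⟦ Δ^ d ⟧ (⟦ Δ ⟧ (⟦ Boxes a (suc d) ⟧ (⟦ Box b ⟧ q))) n
      ≡⟨ op-cong (Δ^ d) (op-comm {⟦ Box b ⟧ q} Δ (Boxes a (suc d))) n ⟩
    ⟦ Δ^ d ⟧ (⟦ Boxes a (suc d) ⟧ (⟦ Δ ⟧ (⟦ Box b ⟧ q))) n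
      ≡⟨ op-cong (Δ^ d ⊙ Boxes a (suc d)) (λ n → trans (Δ-Box b n) (D-p a (suc d) (1≤a (suc d)) n)) n ⟩
    ⟦ Δ^ d ⊙ Boxes a (suc d) ⟧ (⟦ σ b ⟧ (pℤ a (suc d))) n
      ≡⟨ op-σ (Δ^ d ⊙ Boxes a (suc d)) b n ⟩
    ⟦ Δ^ d ⊙ Boxes a (suc d) ⟧ (pℤ a (suc d)) (b + n)
      ≡⟨ eq (b + n) ⟩
    c ∎
    where
    open ≡-Reasoning
    b : ℕ
    b = a (suc d)
    q : Seq
    q = pℤ a (suc (suc d))

  DI-⊤-p : ∀ k → Bd 1 0 (⟦ DI a (⊤ {k}) ⟧ (pℤ a k))
  DI-⊤-p zero = bd 1 λ { zero → ≤-refl ; (suc n) → ≤-trans (≤-reflexive (*-zeroʳ (suc (suc n) ^ 1))) z≤n }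
  DI-⊤-p (suc k) = Bd-cong
    (λ n → sym (trans (DI-⊤-snoc k a n)
      (trans (op-cong (DI a (⊤ {k})) (D-p a k (1≤a k)) n) (op-σ (DI a (⊤ {k})) (a k) n))))
    (Bd-σ (a k) (DI-⊤-p k))

  -- Starting from the full set, where only a shift of `one` is left, indices are removed one at a
  -- time; each removal is a summation and raises the exponent by one.
  DI-p-growth : ∀ {k} e (I : Subset k) → e + ∣ I ∣ ≡ k → Bd 1 e (⟦ DI a I ⟧ (pℤ a k))
  DI-p-growth {k} zero I eq =
    subst (λ I → Bd 1 0 (⟦ DI a I ⟧ (pℤ a k))) (sym (∣p∣≡n⇒p≡⊤ {p = I} eq)) (DI-⊤-p k)
  DI-p-growth {k} (suc e) I eq with ∃-∉ I (subst (suc ∣ I ∣ ≤_) eq (s≤s (m≤n+m ∣ I ∣ e)))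
  ... | i , i∉I = Bd-suc (integrate (⟦ DI a I ⟧ (pℤ a k)) (a (toℕ i)) (1≤a (toℕ i))
    (Bd-cong (λ n → sym (DI-insert a i I i∉I n)) (DI-p-growth e (I [ i ]≔ inside)
      (trans (cong (λ s → e + s) (∣insert∣ i I i∉I)) (trans (+-suc e ∣ I ∣) eq)))))

  module _ {k m : ℕ}
    (coprime : (I : Subset k) → ∣ I ∣ ≡ k ∸ m → gcdSub (λ (i : Fin k) → a (toℕ i)) I ≡ 1) where

    -- The complement of `I` contains a set of exactly k - m indices, whose gcd is 1; closure under
    -- gcd then reaches S^1 - 1.
    Δ-from-outside : ∀ e f (I : Subset k) → ∣ I ∣ ≤ m →
      (∀ i → i ∉ I → Bd 1 e (⟦ D (a (toℕ i)) ⟧ f)) → Bd 1 e (⟦ Δ ⟧ f)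
    Δ-from-outside e f I ∣I∣≤m small
      with shrink (k ∸ m) (∁ I) (subst (k ∸ m ≤_) (sym (∣∁p∣≡n∸∣p∣ I)) (∸-monoʳ-≤ k ∣I∣≤m))
    ... | J , ∣J∣≡ , J⊆∁I = subst P (coprime J ∣J∣≡)
      (gcdSub-closed P (Bd-zero λ n → ℤ.+-inverseʳ (f n)) (D-closed-gcd f)
        (λ i → a (toℕ i)) J (λ i i∈J → small i (x∈∁p⇒x∉p (J⊆∁I i∈J))))
      where
      P : ℕ → Set
      P b = Bd 1 e (⟦ D b ⟧ f)

    -- Every `Δ` counts as much as one factor S^{a_i} - 1: it is traded for each i ∉ I in turn. The
    -- budget m + 1 ensures |I| ≤ m whenever a trade takes place.
    DI-Δ^-growth : ∀ j e (I : Subset k) → e + (∣ I ∣ + j) ≡ k → ∣ I ∣ + j ≤ suc m →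
      Bd 1 e (⟦ DI a I ⟧ (⟦ Δ^ j ⟧ (pℤ a k)))
    DI-Δ^-growth zero e I eq _ = DI-p-growth e I (trans (cong (λ s → e + s) (sym (+-identityʳ ∣ I ∣))) eq)
    DI-Δ^-growth (suc j) e I eq ≤m = Bd-cong commute (Δ-from-outside e q I ∣I∣≤m small)
      where
      q : Seq
      q = ⟦ DI a I ⟧ (⟦ Δ^ j ⟧ (pℤ a k))
      commute : ⟦ Δ ⟧ q ≗ ⟦ DI a I ⟧ (⟦ Δ^ (suc j) ⟧ (pℤ a k))
      commute n = trans (op-comm {⟦ Δ^ j ⟧ (pℤ a k)} Δ (DI a I) n)
        (op-cong (DI a I) (op-comm {pℤ a k} Δ (Δ^ j)) n)
      ∣I∣+j≤m : ∣ I ∣ + j ≤ m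
      ∣I∣+j≤m = ≤-pred (subst (_≤ suc m) (+-suc ∣ I ∣ j) ≤m)
      ∣I∣≤m : ∣ I ∣ ≤ m
      ∣I∣≤m = ≤-trans (m≤m+n ∣ I ∣ j) ∣I∣+j≤m
      small : ∀ i → i ∉ I → Bd 1 e (⟦ D (a (toℕ i)) ⟧ q)
      small i i∉I = Bd-cong (λ n → sym (DI-insert a i I i∉I n))
        (DI-Δ^-growth j e (I [ i ]≔ inside)
          (trans (cong (λ s → e + (s + j)) (∣insert∣ i I i∉I))
            (trans (cong (λ s → e + s) (sym (+-suc ∣ I ∣ j))) eq))
          (subst (λ s → s + j ≤ suc m) (sym (∣insert∣ i I i∉I)) (s≤s ∣I∣+j≤m)))

    Δ^-p-growth : ∀ e → e + suc m ≡ k → Bd 1 e (⟦ Δ^ (suc m) ⟧ (pℤ a k))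
    Δ^-p-growth e eq = Bd-cong (DI-⊥ k a) (DI-Δ^-growth (suc m) e ⊥
      (subst (λ s → e + (s + suc m) ≡ k) (sym (∣⊥∣≡0 k)) eq)
      (≤-reflexive (cong (_+ suc m) (∣⊥∣≡0 k))))

  -- Splits b·p = d!·Qp + (b - d!·Q)p with Q = `Boxes a (suc d)`. The multiple `b` avoids rational
  -- coefficients.
  p-smooth : ∀ {d m} → m ≤ d →
    ((I : Subset (suc d)) → ∣ I ∣ ≡ suc d ∸ m → gcdSub (λ (i : Fin (suc d)) → a (toℕ i)) I ≡ 1) →
    ∃ λ b → ∃ λ c → ℤ.0ℤ ℤ.< c × S m d c (⟦ κ b ⟧ (pℤ a (suc d)))
  p-smooth {d} {m} m≤d coprime with Δ-Boxes-p d
  ... | c , 0<c , Δ^h≡c = b , c , 0<c , S-coef m d _ (ℤ.+-identityʳ c)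
    (S-cong m d (λ n → cancel (t ℤ.* h n) (b ℤ.* q n)) (S-+ m d main error))
    where
    t b : ℤ
    t = + (d !)
    -- `aug` of the boxes is ∏ a_i.
    b = t ℤ.* aug (Boxes a (suc d))
    q h : Seq
    q = pℤ a (suc d)
    h = ⟦ Boxes a (suc d) ⟧ q
    E : Op
    E = κ b ⊖ κ t ⊙ Boxes a (suc d)
    main : S m d c (⟦ κ t ⟧ h)
    main = S-weaken (d ∸ m) m d (subst (λ s → S s d c (⟦ κ t ⟧ h)) (sym (m∸n+n≡m m≤d))
      (S-from-Δ^const d λ n → trans (op-κ (Δ^ d) t n) (cong (t ℤ.*_) (Δ^h≡c n))))
    Δ^q : Seq
    Δ^q = ⟦ Δ^ m ⟧ q
    ΔΔ^q-small : Bd 1 (d ∸ m) (⟦ Δ ⟧ Δ^q)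
    ΔΔ^q-small = Bd-cong (λ n → sym (op-comm {q} Δ (Δ^ m) n))
      (Δ^-p-growth coprime (d ∸ m) (trans (+-suc (d ∸ m) m) (cong suc (m∸n+n≡m m≤d))))
    drop-aug : ∀ n → ⟦ E ⟧ Δ^q n ℤ.- aug E ℤ.* Δ^q n ≡ ⟦ Δ^ m ⟧ (⟦ E ⟧ q) n
    drop-aug n = trans
      (cong (λ x → ⟦ E ⟧ Δ^q n ℤ.- x ℤ.* Δ^q n) (ℤ.+-inverseʳ b))
      (trans (ℤ.+-identityʳ (⟦ E ⟧ Δ^q n)) (op-comm {q} E (Δ^ m) n))
    -- `E` vanishes at S = 1, so it is worth one more `Δ` on top of `Δ^ m`.
    error : S m d ℤ.0ℤ (⟦ E ⟧ q)
    error = S-from-Δ^small m d m≤d (Bd-cong drop-aug (aug-approx Δ^q E ΔΔ^q-small))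
    cancel : ∀ x y → x ℤ.+ (y ℤ.- x) ≡ y
    cancel = solve-∀

S⇒AsymptLogConcave : ∀ r d {c} b w → ℤ.0ℤ ℤ.< c → S (r * 2) d c (⟦ κ b ⟧ w) → AsymptLogConcave r w
S⇒AsymptLogConcave r d b w 0<c smooth with S-L^-positive r d 0<c smooth
... | N , pos = N , λ { (suc j) _ j≤r i N≤i → L^-unscale j b w i (pos (suc j) j≤r i N≤i) }

theorem4p8 : (a : ℕ → ℕ) → (∀ i → 1 ≤ a i) → (∀ i → a i ≤ a (suc i)) →
    (r k : ℕ) → 1 ≤ r → 2 * r < k →
    ((I : Subset k) → ∣ I ∣ ≡ k ∸ 2 * r → gcdSub (λ (i : Fin k) → a (toℕ i)) I ≡ 1) →
    AsymptLogConcave r (λ n → + pA a k n)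
-- The degree is d = k - 1, and r applications of `L` spend 2r ≤ d differences.
theorem4p8 a 1≤a _ r (suc d) _ (s≤s 2r≤d) coprime =
  let b , c , 0<c , smooth = p-smooth a 1≤a 2r≤d coprime
  in S⇒AsymptLogConcave r d b (pℤ a (suc d)) 0<c
       (subst (λ m → S m d c (⟦ κ b ⟧ (pℤ a (suc d)))) (*-comm 2 r) smooth)
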